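{- Let $(N_1,m_1)$ and $(N_2,m_2)$ be labeled marked Petri nets, with place sets $P_1=\{p^1_1,\dots,p^1_k\}$ and $P_2=\{p^2_1,\dots,p^2_l\}$, and let $E$ be a system of linear constraints such that $(N_1,m_1)\vartriangleright_E(N_2,m_2)$. Let $F_1$ be a formula whose free variables satisfy $(\mathrm{fv}(F_1)\setminus P_1)\cap(\mathrm{fv}(E)\setminus P_1)=\emptyset$, and let $F_2(\vec y)\triangleq\exists\vec x.\ \tilde E(\vec x,\vec y)\wedge F_1(\vec x)$ be the $E$-transform of $F_1$. Then $F_1$ is reachable in $(N_1,m_1)$ if and only if $F_2$ is reachable in $(N_2,m_2)$.
   Context: A Petri net $N=(P,T,\mathrm{Pre},\mathrm{Post})$ has a finite set of places $P$, a finite set of transitions $T$ disjoint from $P$, and flow functions $\mathrm{Pre},\mathrm{Post}:T\to(P\to\mathbb N)$. A marking is a map $m:P\to\mathbb N$; a marked net is a pair $(N,m)$. Transition $t$ is enabled at $m$ if $m(p)\ge\mathrm{Pre}(t,p)$ for all $p$; firing it yields $m'=m-\mathrm{Pre}(t)+\mathrm{Post}(t)$, written $m\xrightarrow{t}m'$. A firing sequence $\varrho=t_1\cdots t_n$ is fired from $m$ to $m'$ ($m\overset{\varrho}{\Rightarrow}m'$) if there are markings $m=m_0,\dots,m_n=m'$ with $m_i\xrightarrow{t_{i+1}}m_{i+1}$. $R(N,m_0)$ is the set of markings reachable from $m_0$. A labeled net has a labeling $l:T\to\Sigma\cup\{\tau\}$ ($\tau\notin\Sigma$ a silent symbol), extended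 to sequences by $l(\epsilon)=\epsilon$, $\tau$ mapped to $\epsilon$, and $l(\varrho t)=l(\varrho)l(t)$. Formulas are Boolean combinations of linear (in)equalities over integer variables; place names are used as variables. For a marking $m$ over $P=\{p_1,\dots,p_n\}$, $\underline m\triangleq\bigwedge_i(p_i=m(p_i))$. A marking $m$ satisfies $\phi$, written $m\models\phi$, when $\phi\wedge\underline m$ is satisfiable over the integers ($\phi$ may contain variables that are not places). $\phi$ is reachable in $(N,m_0)$ if there is $m\in R(N,m_0)$ with $m\models\phi$. Markings $m_1$ over $P_1$ and $m_2$ over $P_2$ are compatible if $m_1(p)=m_2(p)$ for all $p\in P_1\cap P_2$; then $m_1\uplus m_2$ is the marking over $P_1\cup P_2$ equal to $m_1$ on $P_1$ and to $m_2$ on $P_2\setminus P_1$; writing $m_1\uplus m_2\models E$ presupposes compatibility. $E$-abstraction: for labeled nets $N_1,N_2$ (labelings $l_1,l_2$ over the same alphabet $\Sigma$) with places $P_1,P_2$ and a system $E$ of linear constraints (which may contain variables outside $P_1\cup P_2$), $(N_1,m_1)\sqsupseteq_E(N_2,m_2)$ holds iff (A1) $m_1\uplus m_2\models E$; and (A2) for every firing sequence $m_1\overset{\varrho_1}{\Rightarrow}m_1'$ in $N_1$ there is at least one marking $m_2'$ over $P_2$ with $m_1'\uplus m_2'\models E$, and for every marking $m_2'$ over $P_2$ with $m_1'\uplus m_2'\models E$ there is a firing sequence $\varrho_2$ of $N_2$ with $m_2\overset{\varrho_2}{\Rightarrow}m_2'$ and $l_1(\varrho_1)=l_2(\varrho_2)$.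 $(N_1,m_1)\vartriangleright_E(N_2,m_2)$ means both $(N_1,m_1)\sqsupseteq_E(N_2,m_2)$ and $(N_2,m_2)\sqsupseteq_E(N_1,m_1)$. $E$-transform: with $\vec p_1=(p^1_1,\dots,p^1_k)$, $\vec p_2=(p^2_1,\dots,p^2_l)$, and disjoint vectors of fresh variables $\vec x=(x_1,\dots,x_k)$, $\vec y=(y_1,\dots,y_l)$, define $\tilde E(\vec x,\vec y)\triangleq E\{\vec p_1\leftarrow\vec x\}\{\vec p_2\leftarrow\vec y\}\wedge\bigwedge_{\{(i,j)\mid p^1_i=p^2_j\}}(x_i=y_j)$; $F_1(\vec x)$ denotes $F_1$ with place $p^1_i$ replaced by $x_i$, and $F_2(\vec y)$ is evaluated on markings of $N_2$ with $y_j$ standing for $p^2_j$.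
   Formalization: In F_2 the bound variables x⃗ range over the natural numbers (token counts) instead of the integers; over the integers the claim fails, e.g. N_1 one place p filled by a silent transition, N_2 one place q and no transition, both empty, E: q=0, F_1: p=-1. -}

module Defs where

open import Data.Fin using (Fin)
open import Data.Integer as ℤ using (ℤ; +_)
open import Data.List using (List; []; _∷_; [_]; _++_; map; foldr; filter; mapMaybe; allFin; cartesianProduct)
open import Data.List.Membership.Propositional using (_∈_)
open import Data.List.Relation.Binary.Disjoint.Propositional using (Disjoint)
open import Data.List.Relation.Unary.Unique.Propositional using (Unique)
open import Data.Maybe using (Maybe)
open import Data.Nat as ℕ using (ℕ; _≟_)
import Data.List.Membership.DecPropositional as DecMembership
open import Data.Product using (Σ; ∃; _×_; _,_; proj₁; proj₂)
open import Data.Sum using (_⊎_)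
open import Data.Unit using (⊤)
open import Data.Vec as Vec using (Vec; []; _∷_; lookup; toList)
open import Relation.Binary.PropositionalEquality using (_≡_)
open import Relation.Nullary using (¬_; yes; no)
open import Relation.Nullary.Decidable using (¬?)

open DecMembership _≟_ using (_∈?_)

-- A countable supply of names, shared by the places of all nets and by the
-- other variables of formulas.
Var : Set
Var = ℕ

_∖_ : List Var → List Var → List Var
xs ∖ ys = filter (λ v → ¬? (v ∈? ys)) xs

------------------------------------------------------------------------
-- Formulas

infix  8 _·_
infixl 7 _∔_
infix  6 _≐_ _≤̇_ _<̇_
infixr 5 _∧̇_
infixr 4 _∨̇_

data Term : Set where
  const : ℤ → Term
  var   : Var → Term
  _·_   : ℤ → Term → Term
  _∔_   : Term → Term → Term

data Constraint : Set where
  _≐_ _≤̇_ _<̇_ : Term → Term → Constraint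

-- Systems are read conjunctively.
System : Set
System = List Constraint

data Fragment : Set where
  boolean quantified : Fragment

data Formula : Fragment → Set where
  atom      : ∀ {k} → Constraint → Formula k
  ⊤̇         : ∀ {k} → Formula k
  _∧̇_ _∨̇_   : ∀ {k} → Formula k → Formula k → Formula k
  ¬̇_        : ∀ {k} → Formula k → Formula k
  ∃̇         : Var → Formula quantified → Formula quantified

⋀ : ∀ {k} → List Constraint → Formula k
⋀ = foldr (λ c φ → atom c ∧̇ φ) ⊤̇

∃̇* : List Var → Formula quantified → Formula quantified
∃̇* xs φ = foldr ∃̇ φ xs

fvᵗ : Term → List Var
fvᵗ (const _) = []
fvᵗ (var v)   = [ v ]
fvᵗ (_ · t)   = fvᵗ t
fvᵗ (s ∔ t)   = fvᵗ s ++ fvᵗ t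

fvᶜ : Constraint → List Var
fvᶜ (s ≐ t) = fvᵗ s ++ fvᵗ t
fvᶜ (s ≤̇ t) = fvᵗ s ++ fvᵗ t
fvᶜ (s <̇ t) = fvᵗ s ++ fvᵗ t

fv : ∀ {k} → Formula k → List Var
fv (atom c) = fvᶜ c
fv ⊤̇        = []
fv (φ ∧̇ ψ)  = fv φ ++ fv ψ
fv (φ ∨̇ ψ)  = fv φ ++ fv ψ
fv (¬̇ φ)    = fv φ
fv (∃̇ x φ)  = fv φ ∖ [ x ]

Valuation : Set
Valuation = Var → ℤ

_[_≔_] : Valuation → Var → ℤ → Valuation
(ρ [ x ≔ n ]) v with v ≟ x
... | yes _ = n
... | no  _ = ρ v

⟦_⟧ : Term → Valuation → ℤ
⟦ const c ⟧ ρ = c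
⟦ var v   ⟧ ρ = ρ v
⟦ c · t   ⟧ ρ = c ℤ.* ⟦ t ⟧ ρ
⟦ s ∔ t   ⟧ ρ = ⟦ s ⟧ ρ ℤ.+ ⟦ t ⟧ ρ

infix 3 _⊩ᶜ_ _⊩_

_⊩ᶜ_ : Valuation → Constraint → Set
ρ ⊩ᶜ s ≐ t = ⟦ s ⟧ ρ ≡ ⟦ t ⟧ ρ
ρ ⊩ᶜ s ≤̇ t = ⟦ s ⟧ ρ ℤ.≤ ⟦ t ⟧ ρ
ρ ⊩ᶜ s <̇ t = ⟦ s ⟧ ρ ℤ.< ⟦ t ⟧ ρ

-- Free variables range over ℤ.  Quantifiers occur only in E-transforms, where
-- the bound variables stand for the token counts of places; they range over ℕ.
-- (Over ℤ the transform would not preserve reachability: take for N₁ one place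
-- p filled by a silent transition, for N₂ one place q and no transition, both
-- initially empty, E the equation q = 0, and F₁ the formula p = -1.)
_⊩_ : ∀ {k} → Valuation → Formula k → Set
ρ ⊩ atom c = ρ ⊩ᶜ c
ρ ⊩ ⊤̇      = ⊤
ρ ⊩ φ ∧̇ ψ  = (ρ ⊩ φ) × (ρ ⊩ ψ)
ρ ⊩ φ ∨̇ ψ  = (ρ ⊩ φ) ⊎ (ρ ⊩ ψ)
ρ ⊩ ¬̇ φ    = ¬ (ρ ⊩ φ)
ρ ⊩ ∃̇ x φ  = Σ ℕ λ n → ρ [ x ≔ + n ] ⊩ φ

Satisfiable : ∀ {k} → Formula k → Set
Satisfiable φ = Σ Valuation λ ρ → ρ ⊩ φ

-- Simultaneous substitution of variables for variables.
_↦_ : ∀ {n} → Vec Var n → Vec Var n → Var → Var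
([] ↦ []) v = v
((p ∷ ps) ↦ (x ∷ xs)) v with v ≟ p
... | yes _ = x
... | no  _ = (ps ↦ xs) v

renameᵗ : (Var → Var) → Term → Term
renameᵗ f (const c) = const c
renameᵗ f (var v)   = var (f v)
renameᵗ f (c · t)   = c · renameᵗ f t
renameᵗ f (s ∔ t)   = renameᵗ f s ∔ renameᵗ f t

renameᶜ : (Var → Var) → Constraint → Constraint
renameᶜ f (s ≐ t) = renameᵗ f s ≐ renameᵗ f t
renameᶜ f (s ≤̇ t) = renameᵗ f s ≤̇ renameᵗ f t
renameᶜ f (s <̇ t) = renameᵗ f s <̇ renameᵗ f t

-- Only defined without binders, so there is no capture; the result may be
-- used in either fragment.
rename : ∀ {k} → (Var → Var) → Formula boolean → Formula k
rename f (atom c) = atom (renameᶜ f c)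
rename f ⊤̇        = ⊤̇
rename f (φ ∧̇ ψ)  = rename f φ ∧̇ rename f ψ
rename f (φ ∨̇ ψ)  = rename f φ ∨̇ rename f ψ
rename f (¬̇ φ)    = ¬̇ rename f φ

------------------------------------------------------------------------
-- Petri nets

record PetriNet : Set where
  field
    #P #T    : ℕ
    place    : Vec Var #P
    distinct : Unique (toList place)
    pre post : Fin #T → Fin #P → ℕ

  places : List Var
  places = toList place

  Transition : Set
  Transition = Fin #T

  -- The i-th component is the number of tokens in the i-th place.
  Marking : Set
  Marking = Vec ℕ #P

  infix 3 _-[_]→_ _=[_]⇒_

  record _-[_]→_ (m : Marking) (t : Transition) (m′ : Marking) : Set where
    field
      enabled : ∀ p → pre t p ℕ.≤ lookup m p
      fired   : ∀ p → lookup m′ p ≡ (lookup m p ℕ.∸ pre t p) ℕ.+ post t p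

  data _=[_]⇒_ : Marking → List Transition → Marking → Set where
    ε   : ∀ {m} → m =[ [] ]⇒ m
    _▹_ : ∀ {m m′ m″ t ϱ} → m -[ t ]→ m′ → m′ =[ ϱ ]⇒ m″ → m =[ t ∷ ϱ ]⇒ m″

  ReachableFrom : Marking → Marking → Set
  ReachableFrom m₀ m = ∃ λ ϱ → m₀ =[ ϱ ]⇒ m

-- The silent symbol τ is represented by nothing.
record LabeledNet (Alphabet : Set) : Set where
  field
    net   : PetriNet
    label : PetriNet.Transition net → Maybe Alphabet

  open PetriNet net public

  labels : List Transition → List Alphabet
  labels = mapMaybe label

open LabeledNet

MarkedNet : Set → Set
MarkedNet Alphabet = Σ (LabeledNet Alphabet) Marking

------------------------------------------------------------------------
-- Satisfaction by markings

-- A marking together with the variables that carry its components.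
NamedMarking : Set
NamedMarking = List (Var × ℕ)

_≔_ : ∀ {n} → Vec Var n → Vec ℕ n → NamedMarking
xs ≔ m = toList (Vec.zip xs m)

⌊_⌋ : ∀ {k} → NamedMarking → Formula k
⌊ M ⌋ = ⋀ (map (λ (p , n) → var p ≐ const (+ n)) M)

infix 3 _⊨_

_⊨_ : ∀ {k} → NamedMarking → Formula k → Set
M ⊨ φ = Satisfiable (φ ∧̇ ⌊ M ⌋)

Compatible : NamedMarking → NamedMarking → Set
Compatible M₁ M₂ = ∀ {p n₁ n₂} → (p , n₁) ∈ M₁ → (p , n₂) ∈ M₂ → n₁ ≡ n₂

infixr 5 _⊎ᵐ_
infix 3 _⊎_⊨ˢ_

_⊎ᵐ_ : NamedMarking → NamedMarking → NamedMarking
M₁ ⊎ᵐ M₂ = M₁ ++ filter (λ (p , _) → ¬? (p ∈? map proj₁ M₁)) M₂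

_⊎_⊨ˢ_ : NamedMarking → NamedMarking → System → Set
M₁ ⊎ M₂ ⊨ˢ E = Compatible M₁ M₂ × (M₁ ⊎ᵐ M₂ ⊨ ⋀ {boolean} E)

-- Reachability of a formula in which xs stands for the places of the net.
FormulaReachableVia : ∀ {A k} ((N , _) : MarkedNet A) → Vec Var (#P N) → Formula k → Set
FormulaReachableVia (N , m₀) xs φ =
  Σ (Marking N) λ m → ReachableFrom N m₀ m × (xs ≔ m ⊨ φ)

FormulaReachable : ∀ {A k} → MarkedNet A → Formula k → Set
FormulaReachable M φ = FormulaReachableVia M (place (proj₁ M)) φ

------------------------------------------------------------------------
-- E-abstraction

infix 3 _⊒[_]_ _▷[_]_

record _⊒[_]_ {A : Set} (M₁ : MarkedNet A) (E : System) (M₂ : MarkedNet A) : Set where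
  private
    N₁ = proj₁ M₁
    m₁ = proj₂ M₁
    N₂ = proj₁ M₂
    m₂ = proj₂ M₂
    module N₁ = LabeledNet N₁
    module N₂ = LabeledNet N₂
  field
    A1 : (N₁.place ≔ m₁) ⊎ (N₂.place ≔ m₂) ⊨ˢ E
    A2 : ∀ {ϱ₁ m₁′} → m₁ N₁.=[ ϱ₁ ]⇒ m₁′ →
         (∃ λ m₂′ → (N₁.place ≔ m₁′) ⊎ (N₂.place ≔ m₂′) ⊨ˢ E) ×
         (∀ m₂′ → (N₁.place ≔ m₁′) ⊎ (N₂.place ≔ m₂′) ⊨ˢ E →
          ∃ λ ϱ₂ → (m₂ N₂.=[ ϱ₂ ]⇒ m₂′) × N₁.labels ϱ₁ ≡ N₂.labels ϱ₂)

_▷[_]_ : ∀ {A} → MarkedNet A → System → MarkedNet A → Set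
M₁ ▷[ E ] M₂ = (M₁ ⊒[ E ] M₂) × (M₂ ⊒[ E ] M₁)

------------------------------------------------------------------------
-- E-transform

record Fresh {k l} (xs : Vec Var k) (ys : Vec Var l) (used : List Var) : Set where
  field
    unique : Unique (toList xs ++ toList ys)
    unused : Disjoint (toList xs ++ toList ys) used

sharedEqualities : ∀ {k l} → Vec Var k → Vec Var l → Vec Var k → Vec Var l → List Constraint
sharedEqualities {k} {l} ps qs xs ys =
  map (λ (i , j) → var (lookup xs i) ≐ var (lookup ys j))
      (filter (λ (i , j) → lookup ps i ≟ lookup qs j)
              (cartesianProduct (allFin k) (allFin l)))

Ẽ : ∀ {f k l} → System → Vec Var k → Vec Var l → Vec Var k → Vec Var l → Formula f
Ẽ E ps qs xs ys = rename (qs ↦ ys) (rename (ps ↦ xs) (⋀ E)) ∧̇ ⋀ (sharedEqualities ps qs xs ys)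

E-transform : ∀ {k l} → System → Vec Var k → Vec Var l → Vec Var k → Vec Var l →
              Formula boolean → Formula quantified
E-transform E ps qs xs ys F₁ =
  ∃̇* (toList xs) (Ẽ E ps qs xs ys ∧̇ rename (ps ↦ xs) F₁)

{-# OPTIONS --safe #-}
-- A marking m₂ satisfies the E-transform of F₁ exactly when some marking m₁
-- satisfies F₁ and is related to m₂ by E.  Given this, reachability of F₁ in N₁
-- transfers to N₂ along N₁ ⊒ N₂, which provides a related m₂, and back along
-- N₂ ⊒ N₁, which makes every related m₁ reachable.
module Submission where

open import Defs
open import Data.Fin using (Fin; zero; suc)
open import Data.Integer as ℤ using (+_)
open import Data.Integer.Properties using (+-injective)
open import Data.List using (List; []; _∷_; _++_; map; allFin; cartesianProduct)
open import Data.List.Membership.Propositional using (_∈_; _∉_)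
open import Data.List.Membership.Propositional.Properties using (∈-++⁺ˡ; ∈-++⁺ʳ; ∈-map⁻; ∈-filter⁺; ∈-allFin; ∈-cartesianProduct⁺)
import Data.List.Membership.DecPropositional as DecMembership
open import Data.List.Relation.Binary.Disjoint.Propositional using (Disjoint)
open import Data.List.Relation.Unary.All as All using (All; []; _∷_)
import Data.List.Relation.Unary.All.Properties as All
open import Data.List.Relation.Unary.AllPairs using ([]; _∷_)
open import Data.List.Relation.Unary.Any using (here; there)
open import Data.List.Relation.Unary.Unique.Propositional using (Unique)
open import Data.Nat using (ℕ; _≟_)
open import Data.Product using (∃; _×_; _,_; proj₁; proj₂)
open import Data.Product.Function.NonDependent.Propositional using (_×-⇔_)
open import Data.Sum.Function.Propositional using (_⊎-⇔_)
open import Data.Vec using (Vec; []; _∷_; lookup; toList)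
import Data.Vec.Membership.Propositional.Properties as Vec
import Data.Vec.Relation.Unary.Any as VecAny
import Data.Vec.Relation.Unary.Any.Properties as VecAny
open import Function using (_∘_)
open import Function.Bundles using (_⇔_; mk⇔; Equivalence)
open import Function.Construct.Identity using (⇔-id)
open import Function.Related.TypeIsomorphisms using (¬-cong-⇔)
open import Relation.Binary.PropositionalEquality using (_≡_; refl; sym; trans; cong; cong₂; module ≡-Reasoning)
open import Relation.Nullary using (yes; no; contradiction)
open import Relation.Nullary.Decidable using (¬?)
open LabeledNet using (Marking; #P; place; places; distinct)

open DecMembership _≟_ using (_∈?_)
open Equivalence using (to; from)

-- Lists and vectors.

Unique-++⁻ : ∀ {A : Set} (xs {ys} : List A) → Unique (xs ++ ys) →
             Unique xs × Unique ys × Disjoint xs ys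
Unique-++⁻ []       ys! = [] , ys! , λ ()
Unique-++⁻ (x ∷ xs) (x≢ ∷ xsys!) =
  let xs! , ys! , xs#ys = Unique-++⁻ xs xsys!
      x≢xs , x≢ys       = All.++⁻ xs x≢
  in x≢xs ∷ xs! , ys! , λ where
       (here refl , x∈ys) → All.lookup x≢ys x∈ys refl
       (there v∈xs , v∈ys) → xs#ys (v∈xs , v∈ys)

module _ {A : Set} where

  lookup∈toList : ∀ {n} i (xs : Vec A n) → lookup xs i ∈ toList xs
  lookup∈toList i xs = Vec.∈-toList⁺ (Vec.∈-lookup i xs)

  ∈toList⇒lookup : ∀ {n v} {xs : Vec A n} → v ∈ toList xs → ∃ λ i → v ≡ lookup xs i
  ∈toList⇒lookup v∈xs = let v∈ = Vec.∈-toList⁻ v∈xs in VecAny.index v∈ , VecAny.lookup-index v∈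

-- Substitution of variables for variables.

↦-∉ : ∀ {n} (ps xs : Vec Var n) {v} → v ∉ toList ps → (ps ↦ xs) v ≡ v
↦-∉ []       []       v∉ = refl
↦-∉ (p ∷ ps) (x ∷ xs) {v} v∉ with v ≟ p
... | yes v≡p = contradiction (here v≡p) v∉
... | no  _   = ↦-∉ ps xs (v∉ ∘ there)

-- The substitution follows the first match in `ps`; distinctness keeps an earlier entry from
-- capturing the `i`-th one.
↦-lookup : ∀ {n} (ps xs : Vec Var n) → Unique (toList ps) → ∀ i → (ps ↦ xs) (lookup ps i) ≡ lookup xs i
↦-lookup (p ∷ ps) (x ∷ xs) (p≢ ∷ ps!) zero with p ≟ p
... | yes _   = refl
... | no  p≢p = contradiction refl p≢p
↦-lookup (p ∷ ps) (x ∷ xs) (p≢ ∷ ps!) (suc i) with lookup ps i ≟ p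
... | yes eq = contradiction (sym eq) (All.lookup p≢ (lookup∈toList i ps))
... | no  _  = ↦-lookup ps xs ps! i

-- Simultaneous updates of a valuation.

infixl 9 _[_≔*_]

-- The head is updated first, in the order in which `∃̇*` opens its quantifiers, so `⊩-∃̇*` needs no
-- exchange of updates.
_[_≔*_] : ∀ {n} → Valuation → Vec Var n → Vec ℕ n → Valuation
ρ [ []     ≔* []     ] = ρ
ρ [ x ∷ xs ≔* n ∷ ns ] = (ρ [ x ≔ + n ]) [ xs ≔* ns ]

≔*-∉ : ∀ {n ρ} (xs : Vec Var n) (m : Vec ℕ n) {v} → v ∉ toList xs → (ρ [ xs ≔* m ]) v ≡ ρ v
≔*-∉ []       []      v∉ = refl
≔*-∉ {ρ = ρ} (x ∷ xs) (n ∷ m) {v} v∉ = trans (≔*-∉ xs m (v∉ ∘ there)) head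
  where
  head : (ρ [ x ≔ + n ]) v ≡ ρ v
  head with v ≟ x
  ... | yes v≡x = contradiction (here v≡x) v∉
  ... | no  _   = refl

-- A name listed twice would end with its last value; distinctness keeps each value from being
-- overwritten later.
≔*-lookup : ∀ {n ρ} (xs : Vec Var n) (m : Vec ℕ n) → Unique (toList xs) →
            ∀ i → (ρ [ xs ≔* m ]) (lookup xs i) ≡ + lookup m i
≔*-lookup {ρ = ρ} (x ∷ xs) (n ∷ m) (x≢ ∷ xs!) zero =
  trans (≔*-∉ xs m (λ x∈ → All.lookup x≢ x∈ refl)) head
  where
  head : (ρ [ x ≔ + n ]) x ≡ + n
  head with x ≟ x
  ... | yes _   = refl
  ... | no  x≢x = contradiction refl x≢x
≔*-lookup (x ∷ xs) (n ∷ m) (x≢ ∷ xs!) (suc i) = ≔*-lookup xs m xs! i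

-- Semantics of quantifier blocks, conjunctions and renamings.

⊩-∃̇* : ∀ {n ρ} (xs : Vec Var n) {φ} → (ρ ⊩ ∃̇* (toList xs) φ) ⇔ ∃ λ m → ρ [ xs ≔* m ] ⊩ φ
⊩-∃̇* []       = mk⇔ (λ h → [] , h) (λ { ([] , h) → h })
⊩-∃̇* (x ∷ xs) = mk⇔
  (λ (n , h) → let m , h′ = to (⊩-∃̇* xs) h in n ∷ m , h′)
  (λ { (n ∷ m , h) → n , from (⊩-∃̇* xs) (m , h) })

⊩-⋀ : ∀ {k ρ} cs → (ρ ⊩ ⋀ {k} cs) ⇔ All (ρ ⊩ᶜ_) cs
⊩-⋀ []       = mk⇔ (λ _ → []) _
⊩-⋀ (c ∷ cs) = mk⇔
  (λ (h , hs) → h ∷ to (⊩-⋀ cs) hs)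
  (λ { (h ∷ hs) → h , from (⊩-⋀ cs) hs })

module _ (f : Var → Var) {ρ σ : Valuation} where

  ⟦rename⟧ : ∀ t → (∀ {v} → v ∈ fvᵗ t → ρ (f v) ≡ σ v) → ⟦ renameᵗ f t ⟧ ρ ≡ ⟦ t ⟧ σ
  ⟦rename⟧ (const c) eq = refl
  ⟦rename⟧ (var v)   eq = eq (here refl)
  ⟦rename⟧ (c · t)   eq = cong (c ℤ.*_) (⟦rename⟧ t eq)
  ⟦rename⟧ (s ∔ t)   eq =
    cong₂ ℤ._+_ (⟦rename⟧ s (eq ∘ ∈-++⁺ˡ)) (⟦rename⟧ t (eq ∘ ∈-++⁺ʳ (fvᵗ s)))

  ⊩ᶜ-rename : ∀ c → (∀ {v} → v ∈ fvᶜ c → ρ (f v) ≡ σ v) → (ρ ⊩ᶜ renameᶜ f c) ⇔ (σ ⊩ᶜ c)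
  ⊩ᶜ-rename (s ≐ t) eq
    rewrite ⟦rename⟧ s (eq ∘ ∈-++⁺ˡ) | ⟦rename⟧ t (eq ∘ ∈-++⁺ʳ (fvᵗ s)) = ⇔-id _
  ⊩ᶜ-rename (s ≤̇ t) eq
    rewrite ⟦rename⟧ s (eq ∘ ∈-++⁺ˡ) | ⟦rename⟧ t (eq ∘ ∈-++⁺ʳ (fvᵗ s)) = ⇔-id _
  ⊩ᶜ-rename (s <̇ t) eq
    rewrite ⟦rename⟧ s (eq ∘ ∈-++⁺ˡ) | ⟦rename⟧ t (eq ∘ ∈-++⁺ʳ (fvᵗ s)) = ⇔-id _

  -- Taking `σ` to be `ρ ∘ f` gives the usual substitution lemma. Agreement is asked only on the
  -- free variables so that `σ` may also be a valuation given in advance.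
  ⊩-rename : ∀ {k} (φ : Formula boolean) → (∀ {v} → v ∈ fv φ → ρ (f v) ≡ σ v) →
             (ρ ⊩ rename {k} f φ) ⇔ (σ ⊩ φ)
  ⊩-rename (atom c) eq = ⊩ᶜ-rename c eq
  ⊩-rename ⊤̇        eq = ⇔-id _
  ⊩-rename (φ ∧̇ ψ)  eq = ⊩-rename φ (eq ∘ ∈-++⁺ˡ) ×-⇔ ⊩-rename ψ (eq ∘ ∈-++⁺ʳ (fv φ))
  ⊩-rename (φ ∨̇ ψ)  eq = ⊩-rename φ (eq ∘ ∈-++⁺ˡ) ⊎-⇔ ⊩-rename ψ (eq ∘ ∈-++⁺ʳ (fv φ))
  ⊩-rename (¬̇ φ)    eq = ¬-cong-⇔ (⊩-rename φ eq)

-- Valuations realizing markings, and joint satisfaction of a system.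

_Realizes_ : Valuation → NamedMarking → Set
ρ Realizes M = All (λ (p , n) → ρ p ≡ + n) M

⊩-⌊⌋ : ∀ {k ρ} M → (ρ ⊩ ⌊_⌋ {k} M) ⇔ ρ Realizes M
⊩-⌊⌋ M = mk⇔ (All.map⁻ ∘ to (⊩-⋀ _)) (from (⊩-⋀ _) ∘ All.map⁺)

Realizes-≔ : ∀ {n ρ} (xs : Vec Var n) (m : Vec ℕ n) →
             ρ Realizes (xs ≔ m) ⇔ (∀ i → ρ (lookup xs i) ≡ + lookup m i)
Realizes-≔ []       []      = mk⇔ (λ _ ()) (λ _ → [])
Realizes-≔ (x ∷ xs) (n ∷ m) = mk⇔
  (λ { (h ∷ hs) zero → h ; (h ∷ hs) (suc i) → to (Realizes-≔ xs m) hs i })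
  (λ h → h zero ∷ from (Realizes-≔ xs m) (h ∘ suc))

JointlySatisfiable : NamedMarking → NamedMarking → System → Set
JointlySatisfiable M₁ M₂ E = ∃ λ ρ → (ρ ⊩ ⋀ {boolean} E) × ρ Realizes M₁ × ρ Realizes M₂

-- A valuation realizing both markings gives each shared place one value, whence compatibility.
-- Conversely, compatibility recovers the entries of `M₂` that `_⊎ᵐ_` drops.
⊨ˢ⇔jointlySatisfiable : ∀ M₁ M₂ E → (M₁ ⊎ M₂ ⊨ˢ E) ⇔ JointlySatisfiable M₁ M₂ E
⊨ˢ⇔jointlySatisfiable M₁ M₂ E = mk⇔ joint split
  where
  new? = λ ((p , _) : Var × ℕ) → ¬? (p ∈? map proj₁ M₁)

  joint : M₁ ⊎ M₂ ⊨ˢ E → JointlySatisfiable M₁ M₂ E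
  joint (compatible , ρ , E′ , M) = ρ , E′ , M₁-realized , All.tabulate M₂-realized
    where
    realized = All.++⁻ M₁ (to (⊩-⌊⌋ (M₁ ⊎ᵐ M₂)) M)
    M₁-realized = proj₁ realized

    M₂-realized : ∀ {(p , n) : Var × ℕ} → (p , n) ∈ M₂ → ρ p ≡ + n
    M₂-realized {p , n} pn∈M₂ with p ∈? map proj₁ M₁
    ... | no  p∉ = All.lookup (proj₂ realized) (∈-filter⁺ new? pn∈M₂ p∉)
    ... | yes p∈ with (_ , _) , pn′∈M₁ , refl ← ∈-map⁻ proj₁ p∈ =
      trans (All.lookup M₁-realized pn′∈M₁) (cong +_ (compatible pn′∈M₁ pn∈M₂))

  split : JointlySatisfiable M₁ M₂ E → M₁ ⊎ M₂ ⊨ˢ E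
  split (ρ , E′ , r₁ , r₂) =
    (λ p₁ p₂ → +-injective (trans (sym (All.lookup r₁ p₁)) (All.lookup r₂ p₂))) ,
    ρ , E′ , from (⊩-⌊⌋ (M₁ ⊎ᵐ M₂)) (All.++⁺ r₁ (All.filter⁺ new? r₂))

-- `_⊎ᵐ_` favours its first argument, but `JointlySatisfiable` is symmetric. The swap is needed
-- because the two abstractions in `_▷[_]_` list the markings in opposite orders.
⊨ˢ-sym : ∀ M₁ M₂ E → M₁ ⊎ M₂ ⊨ˢ E → M₂ ⊎ M₁ ⊨ˢ E
⊨ˢ-sym M₁ M₂ E h = let ρ , E′ , r₁ , r₂ = to (⊨ˢ⇔jointlySatisfiable M₁ M₂ E) h in
  from (⊨ˢ⇔jointlySatisfiable M₂ M₁ E) (ρ , E′ , r₂ , r₁)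

-- Satisfaction of the E-transform.

⊩-sharedEqualities : ∀ {f k l ρ} (ps : Vec Var k) (qs : Vec Var l) xs ys →
  (ρ ⊩ ⋀ {f} (sharedEqualities ps qs xs ys)) ⇔
  (∀ i j → lookup ps i ≡ lookup qs j → ρ (lookup xs i) ≡ ρ (lookup ys j))
⊩-sharedEqualities {k = k} {l} ps qs xs ys = mk⇔
  (λ h i j eq → All.lookup (All.map⁻ (to (⊩-⋀ _) h))
    (∈-filter⁺ shared? (∈-cartesianProduct⁺ (∈-allFin i) (∈-allFin j)) eq))
  (λ h → from (⊩-⋀ _) (All.map⁺ (All.map (h _ _) (All.all-filter shared? pairs))))
  where
  shared? = λ ((i , j) : Fin k × Fin l) → lookup ps i ≟ lookup qs j
  pairs   = cartesianProduct (allFin k) (allFin l)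

module _ {k l} (E : System) (ps : Vec Var k) (qs : Vec Var l) (xs : Vec Var k) (ys : Vec Var l)
         (F : Formula boolean)
         (ps! : Unique (toList ps)) (qs! : Unique (toList qs))
         (F#E : Disjoint (fv F ∖ toList ps) (fv {boolean} (⋀ E) ∖ toList ps))
         (fresh : Fresh xs ys (toList ps ++ toList qs ++ fv {boolean} (⋀ E) ++ fv F))
         where
  private
    open Fresh fresh

    xs! = proj₁ (Unique-++⁻ (toList xs) unique)
    ys! = proj₁ (proj₂ (Unique-++⁻ (toList xs) unique))
    xs#ys = proj₂ (proj₂ (Unique-++⁻ (toList xs) unique))

    fvE = fv {boolean} (⋀ E)
    inE : ∀ {v} → v ∈ fvE → v ∈ toList ps ++ toList qs ++ fvE ++ fv F
    inE = ∈-++⁺ʳ (toList ps) ∘ ∈-++⁺ʳ (toList qs) ∘ ∈-++⁺ˡ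
    inF : ∀ {v} → v ∈ fv F → v ∈ toList ps ++ toList qs ++ fvE ++ fv F
    inF = ∈-++⁺ʳ (toList ps) ∘ ∈-++⁺ʳ (toList qs) ∘ ∈-++⁺ʳ fvE

    x∉qs : ∀ i → lookup xs i ∉ toList qs
    x∉qs i x∈qs = unused (∈-++⁺ˡ (lookup∈toList i xs) , ∈-++⁺ʳ (toList ps) (∈-++⁺ˡ x∈qs))

    y∉xs : ∀ j → lookup ys j ∉ toList xs
    y∉xs j y∈xs = xs#ys (y∈xs , lookup∈toList j ys)

    -- The fresh `xs` avoid `qs`, so the second substitution leaves the outcome of the first
    -- untouched.
    rename-p : ∀ i → (qs ↦ ys) ((ps ↦ xs) (lookup ps i)) ≡ lookup xs i
    rename-p i rewrite ↦-lookup ps xs ps! i = ↦-∉ qs ys (x∉qs i)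

    -- Shared places are excluded because the first substitution already sends them to `xs`.
    rename-q : ∀ j → lookup qs j ∉ toList ps → (qs ↦ ys) ((ps ↦ xs) (lookup qs j)) ≡ lookup ys j
    rename-q j q∉ps rewrite ↦-∉ ps xs q∉ps = ↦-lookup qs ys qs! j

    rename-other : ∀ {v} → v ∉ toList ps → v ∉ toList qs → (qs ↦ ys) ((ps ↦ xs) v) ≡ v
    rename-other v∉ps v∉qs rewrite ↦-∉ ps xs v∉ps = ↦-∉ qs ys v∉qs

  -- The left side has one valuation for both `E` and `F`, the right side one for each. Splitting
  -- composes the single valuation with the renamings; merging relies on `F#E`, which leaves `E` and
  -- `F` no common variable outside `ps`.
  ⊨-E-transform : ∀ m₂ →
    (ys ≔ m₂ ⊨ E-transform E ps qs xs ys F) ⇔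
    ∃ λ m₁ → (ps ≔ m₁ ⊨ F) × ((ps ≔ m₁) ⊎ (qs ≔ m₂) ⊨ˢ E)
  ⊨-E-transform m₂ = mk⇔ extract build
    where
    extract : ys ≔ m₂ ⊨ E-transform E ps qs xs ys F → _
    -- The values chosen for the quantified `xs` are natural numbers, hence form a marking `m₁`.
    extract (ρ , transform , Y) with to (⊩-∃̇* xs) transform
    ... | m₁ , (E′ , shared) , F′ = m₁ ,
      ( τ ∘ (ps ↦ xs)
      , to (⊩-rename (ps ↦ xs) F (λ _ → refl)) F′
      , from (⊩-⌊⌋ (ps ≔ m₁)) (from (Realizes-≔ ps m₁)
          (λ i → trans (cong τ (↦-lookup ps xs ps! i)) (τ-x i))) ) ,
      from (⊨ˢ⇔jointlySatisfiable (ps ≔ m₁) (qs ≔ m₂) E)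
        ( σ
        , to (⊩-rename (ps ↦ xs) (⋀ E) (λ _ → refl))
            (to (⊩-rename (qs ↦ ys) (rename (ps ↦ xs) (⋀ E)) (λ _ → refl)) E′)
        , from (Realizes-≔ ps m₁) (λ i → trans (cong τ (rename-p i)) (τ-x i))
        , from (Realizes-≔ qs m₂) σ-q )
      where
      τ = ρ [ xs ≔* m₁ ]
      -- This valuation serves `E`, which undergoes both substitutions; `F` undergoes only `ps ↦ xs`
      -- and is witnessed by `τ ∘ (ps ↦ xs)`.
      σ = τ ∘ (qs ↦ ys) ∘ (ps ↦ xs)

      τ-x : ∀ i → τ (lookup xs i) ≡ + lookup m₁ i
      τ-x = ≔*-lookup xs m₁ xs!

      τ-y : ∀ j → τ (lookup ys j) ≡ + lookup m₂ j
      τ-y j = trans (≔*-∉ xs m₁ (y∉xs j)) (to (Realizes-≔ ys m₂) (to (⊩-⌊⌋ (ys ≔ m₂)) Y) j)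

      σ-q : ∀ j → σ (lookup qs j) ≡ + lookup m₂ j
      σ-q j with lookup qs j ∈? toList ps
      ... | no  q∉ps = trans (cong τ (rename-q j q∉ps)) (τ-y j)
      -- A shared place has become a variable of `xs`; only the shared equalities of `Ẽ` tie its
      -- value to `m₂`.
      ... | yes q∈ps = let i , q≡p = ∈toList⇒lookup q∈ps in begin
        σ (lookup qs j)  ≡⟨ cong σ q≡p ⟩
        σ (lookup ps i)  ≡⟨ cong τ (rename-p i) ⟩
        τ (lookup xs i)  ≡⟨ to (⊩-sharedEqualities ps qs xs ys) shared i j (sym q≡p) ⟩
        τ (lookup ys j)  ≡⟨ τ-y j ⟩
        + lookup m₂ j    ∎
        where open ≡-Reasoning

    build : (∃ λ m₁ → (ps ≔ m₁ ⊨ F) × ((ps ≔ m₁) ⊎ (qs ≔ m₂) ⊨ˢ E)) → _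
    build (m₁ , (ρ , F′ , P) , EM) with to (⊨ˢ⇔jointlySatisfiable (ps ≔ m₁) (qs ≔ m₂) E) EM
    ... | σ , E′ , σ-ps , σ-qs =
      base [ ys ≔* m₂ ] ,
      from (⊩-∃̇* xs) (m₁ ,
        ( from (⊩-rename (qs ↦ ys) (rename (ps ↦ xs) (⋀ E)) (λ _ → refl))
            (from (⊩-rename (ps ↦ xs) (⋀ E) τ-E) E′)
        , from (⊩-sharedEqualities ps qs xs ys) (λ i j p≡q → begin
            τ (lookup xs i)  ≡⟨ τ-x i ⟩
            + lookup m₁ i    ≡⟨ sym (σ-p i) ⟩
            σ (lookup ps i)  ≡⟨ cong σ p≡q ⟩
            σ (lookup qs j)  ≡⟨ σ-q j ⟩
            + lookup m₂ j    ≡⟨ sym (τ-y j) ⟩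
            τ (lookup ys j)  ∎) ) ,
        from (⊩-rename (ps ↦ xs) F τ-F) F′) ,
      from (⊩-⌊⌋ (ys ≔ m₂)) (from (Realizes-≔ ys m₂) (≔*-lookup ys m₂ ys!))
      where
      open ≡-Reasoning

      -- The variables of F may include places of N₂ outside N₁; these are
      -- renamed in E but not in F, hence they are evaluated by ρ.
      base : Valuation
      base v with v ∈? fv F
      ... | yes _ = ρ v
      ... | no  _ = σ v

      base-F : ∀ {v} → v ∈ fv F → base v ≡ ρ v
      base-F {v} v∈F with v ∈? fv F
      ... | yes _   = refl
      ... | no  v∉F = contradiction v∈F v∉F

      base-E : ∀ {v} → v ∈ fvE → v ∉ toList ps → base v ≡ σ v
      base-E {v} v∈E v∉ps with v ∈? fv F
      ... | no  _   = refl
      -- Here `ρ` and `σ` could disagree, but `F#E` rules the case out.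
      ... | yes v∈F =
        contradiction (∈-filter⁺ ∉ps? v∈F v∉ps , ∈-filter⁺ ∉ps? v∈E v∉ps) F#E
        where ∉ps? = λ v → ¬? (v ∈? toList ps)

      -- The update of `ys` belongs to the witness outside the quantifiers; that of `xs` is the one
      -- made by `∃̇*`.
      τ = base [ ys ≔* m₂ ] [ xs ≔* m₁ ]

      τ-x : ∀ i → τ (lookup xs i) ≡ + lookup m₁ i
      τ-x = ≔*-lookup xs m₁ xs!

      τ-y : ∀ j → τ (lookup ys j) ≡ + lookup m₂ j
      τ-y j = trans (≔*-∉ xs m₁ (y∉xs j)) (≔*-lookup ys m₂ ys! j)

      τ-used : ∀ {v} → v ∈ toList ps ++ toList qs ++ fvE ++ fv F → τ v ≡ base v
      τ-used v∈ = trans (≔*-∉ xs m₁ (λ v∈xs → unused (∈-++⁺ˡ v∈xs , v∈)))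
                        (≔*-∉ ys m₂ (λ v∈ys → unused (∈-++⁺ʳ (toList xs) v∈ys , v∈)))

      σ-p : ∀ i → σ (lookup ps i) ≡ + lookup m₁ i
      σ-p = to (Realizes-≔ ps m₁) σ-ps

      σ-q : ∀ j → σ (lookup qs j) ≡ + lookup m₂ j
      σ-q = to (Realizes-≔ qs m₂) σ-qs

      τ-E : ∀ {v} → v ∈ fvE → τ ((qs ↦ ys) ((ps ↦ xs) v)) ≡ σ v
      -- A shared place falls under the first case, since `ps ↦ xs` acts before `qs ↦ ys`; there `σ`
      -- realizes `m₁`.
      τ-E {v} v∈E with v ∈? toList ps | v ∈? toList qs
      ... | yes v∈ps | _ with i , refl ← ∈toList⇒lookup {xs = ps} v∈ps =
        trans (cong τ (rename-p i)) (trans (τ-x i) (sym (σ-p i)))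
      ... | no v∉ps | yes v∈qs with j , refl ← ∈toList⇒lookup {xs = qs} v∈qs =
        trans (cong τ (rename-q j v∉ps)) (trans (τ-y j) (sym (σ-q j)))
      ... | no v∉ps | no v∉qs =
        trans (cong τ (rename-other v∉ps v∉qs)) (trans (τ-used (inE v∈E)) (base-E v∈E v∉ps))

      τ-F : ∀ {v} → v ∈ fv F → τ ((ps ↦ xs) v) ≡ ρ v
      τ-F {v} v∈F with v ∈? toList ps
      ... | no v∉ps = trans (cong τ (↦-∉ ps xs v∉ps)) (trans (τ-used (inF v∈F)) (base-F v∈F))
      ... | yes v∈ps with i , refl ← ∈toList⇒lookup {xs = ps} v∈ps = begin
        τ ((ps ↦ xs) (lookup ps i))  ≡⟨ cong τ (↦-lookup ps xs ps! i) ⟩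
        τ (lookup xs i)              ≡⟨ τ-x i ⟩
        + lookup m₁ i                ≡⟨ sym (to (Realizes-≔ ps m₁) (to (⊩-⌊⌋ (ps ≔ m₁)) P) i) ⟩
        ρ (lookup ps i)              ∎

-- Transfer of reachability between the two nets.

theorem5 : ∀ {Alphabet : Set} (N₁ N₂ : LabeledNet Alphabet) (m₁ : Marking N₁) (m₂ : Marking N₂) (E : System) →
    (N₁ , m₁) ▷[ E ] (N₂ , m₂) →
    (F₁ : Formula boolean) →
    Disjoint (fv F₁ ∖ places N₁) (fv {boolean} (⋀ E) ∖ places N₁) →
    (x : Vec Var (#P N₁)) (y : Vec Var (#P N₂)) →
    Fresh x y (places N₁ ++ places N₂ ++ fv {boolean} (⋀ E) ++ fv F₁) →
    FormulaReachable (N₁ , m₁) F₁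
    ⇔ FormulaReachableVia (N₂ , m₂) y (E-transform E (place N₁) (place N₂) x y F₁)
theorem5 N₁ N₂ m₁ m₂ E (N₁⊒N₂ , N₂⊒N₁) F₁ F₁#E x y fresh = mk⇔
  (λ (m₁′ , (_ , run₁) , F) →
    let (m₂′ , related) , simulate = A2 N₁⊒N₂ run₁
        ϱ₂ , run₂ , _ = simulate m₂′ related
    in m₂′ , (ϱ₂ , run₂) , from (transform m₂′) (m₁′ , F , related))
  (λ (m₂′ , (_ , run₂) , F₂) →
    let m₁′ , F , related = to (transform m₂′) F₂
        ϱ₁ , run₁ , _ = proj₂ (A2 N₂⊒N₁ run₂) m₁′ (⊨ˢ-sym (place N₁ ≔ m₁′) (place N₂ ≔ m₂′) E related)
    in m₁′ , (ϱ₁ , run₁) , F)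
  where
  open _⊒[_]_ using (A2)
  transform = ⊨-E-transform E (place N₁) (place N₂) x y F₁ (distinct N₁) (distinct N₂) F₁#E fresh
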